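{- Let $(D,\vec{s})$ be a data distribution derived from a finite projective plane of order $n$ (with $m=n^2+n+1$ machines) or from a finite affine plane of order $n$ (with $m=n^2+n$ machines). Then an ATAC computation using $(D,\vec{s})$ can be load balanced, i.e. the comparisons can be scheduled, each on a machine holding both of the data items compared, so that every machine has the same amount of comparison computations; and the amount of data replication is minimal, i.e. $L(D,\vec{s})=L_{\min}(m)$.
   Context: A data distribution on $m$ machines is a pair $(D,\vec{s})$, where, for some positive integer $x$ (the number of data groups, not fixed in advance), $D=(d_{ij})$ is an $m\times x$ matrix with entries in $\{0,1\}$ ($d_{ij}=1$ iff data group $j$ is stored on machine $i$), and $\vec{s}\in\mathbb{R}^x$ is a column vector with non-negative entries summing to $1$ ($s_j$ is the fraction of all data lying in data group $j$). It is an ATAC (All-to-All Comparison) data distribution if every entry of $D^TD$ is nonzero, i.e. every pair of data groups is held together by some machine. The data storage limit is $L(D,\vec{s})=\max_{1\le i\le m}(D\vec{s})_i$, and $L_{\min}(m)$ is the minimum of $L(D,\vec{s})$ over all ATAC data distributions on $m$ machines (over all $x$). A finite projective plane of order $n$ is a set of $n^2+n+1$ points and $n^2+n+1$ lines with an incidence relation such that: every pair of distinct points has exactly one line passing through both; every pair of distinct lines intersects in exactly one point; every line contains $n+1$ points; every point is on $n+1$ lines. A finite affine plane of order $n$ is a set of $n^2$ points and $n^2+n$ lines with an incidence relation such that: every pair of distinct points has exactly one line passing through both; every line contains $n$ points; every point is on $n+1$ lines. The data distribution derived from such a plane with $v$ points is $(D,\vec{s})$, where $D$ is the zero-one incidence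 matrix (rows indexed by lines, columns by points, entry $1$ iff the line contains the point) and $\vec{s}=(\tfrac1v,\dots,\tfrac1v)^T\in\mathbb{R}^v$. Lines are machines and points are data groups, all of equal size: machine $i$ holds all items of every data group $j$ with $d_{ij}=1$ and no others. In an ATAC computation every data item is compared with every other data item (in the same or in a different data group), each comparison being scheduled on a machine that holds both items. All machines are assumed equally capable and all comparisons are assumed to take approximately the same time. The data set is assumed to be very large, and rounding of the number of items in each data group to an integer is regarded as negligible. A data distribution is called load balanced if every machine has the same amount of comparison computations. (A separate, weaker notion, "effectively load balanced", means that no machine is scheduled more than $1$ computation more than any other machine; formally, exact load balance is only possible if the number of computations is divisible by the number of machines.) -}

module Defs where

open import Algebra.Apartness.Bundles using (HeytingField)
open import Algebra.Bundles using (CommutativeRing)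
open import Algebra.Core using (Op₂)
import Algebra.Apartness.Properties.HeytingCommutativeRing as HeytingProperties
import Algebra.Properties.Semiring.Mult as SemiringMult
import Algebra.Properties.Semiring.Sum as SemiringSum
open import Data.Fin.Base using (Fin; toℕ)
open import Data.Fin.Patterns using (0F; 1F)
open import Data.Fin.Properties using (<-cmp)
open import Data.Nat.Base as ℕ using (ℕ; zero; suc; z≤n; NonZero)
open import Data.Nat.Properties as ℕ using (m^n≢0; m≤n+m; +-mono-≤)
open import Data.Product.Base using (_×_; _,_; proj₁; proj₂; ∃; ∃-syntax)
open import Data.Product using (∃!)
open import Data.Sum.Base using (_⊎_)
open import Data.Vec.Base using (allFin; count)
open import Data.Vec.Functional using (Vector; head; tail)
open import Level as Level using (0ℓ)
open import Relation.Binary.Core using (Rel)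
open import Relation.Binary.Definitions using (Decidable; Tri; tri<; tri≈; tri>)
open import Relation.Binary.Lattice.Definitions using (Supremum)
open import Relation.Binary.PropositionalEquality.Core using (_≡_; _≢_)
open import Relation.Binary.Structures using (IsStrictPartialOrder)
import Relation.Binary.Reasoning.Setoid as SetoidReasoning
open import Relation.Nullary.Decidable.Core using (yes; no)
open import Relation.Nullary.Negation.Core using (¬_)

-- The constructive notion of ordered field (as in the HoTT book, §11.2):
-- the real numbers are an instance both classically and constructively,
-- the latter because neither totality of _≤_ nor decidability is assumed.
-- Binary maxima are part of the structure; the order laws missing here
-- follow from these.
record OrderedField c ℓ₁ ℓ₂ : Set (Level.suc (c Level.⊔ ℓ₁ Level.⊔ ℓ₂)) where
  infix  4 _<_ _≤_
  infixl 6 _⊔_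
  field
    heytingField : HeytingField c ℓ₁ ℓ₂

  open HeytingField heytingField public

  field
    _<_                    : Rel Carrier ℓ₂
    <-isStrictPartialOrder : IsStrictPartialOrder _≈_ _<_
    <⇒#                    : ∀ {x y} → x < y → x # y
    #⇒<⊎>                  : ∀ {x y} → x # y → x < y ⊎ y < x
    0<1                    : 0# < 1#
    +-monoˡ-<              : ∀ z {x y} → x < y → x + z < y + z
    *-pos                  : ∀ {x y} → 0# < x → 0# < y → 0# < x * y

  _≤_ : Rel Carrier ℓ₂
  x ≤ y = ¬ (y < x)

  field
    _⊔_        : Op₂ Carrier
    ⊔-supremum : Supremum _≤_ _⊔_

  commutativeRing : CommutativeRing c ℓ₁
  commutativeRing = record { isCommutativeRing = isCommutativeRing }

  open CommutativeRing commutativeRing public using (semiring)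
  open SemiringSum semiring public using (sum; sum-syntax)
  open SemiringMult semiring public using () renaming (_×_ to _·_)

  private
    module < = IsStrictPartialOrder <-isStrictPartialOrder
    module · = SemiringMult semiring

  0<1+n·1 : ∀ n → 0# < suc n · 1#
  0<1+n·1 zero    = <.<-respʳ-≈ (sym (+-identityʳ 1#)) 0<1
  0<1+n·1 (suc n) = <.trans 0<1
    (<.<-respʳ-≈ (+-comm _ _) (<.<-respˡ-≈ (+-identityˡ 1#) (+-monoˡ-< 1# (0<1+n·1 n))))

  private
    inverse : ∀ n .{{_ : NonZero n}} → ∃[ y ] n · y ≈ 1#
    inverse (suc n) with #⇒invertible (#-sym (<⇒# (0<1+n·1 n)))
    ... | y , _ , v*y≈1 = y , (begin
      suc n · y                ≈⟨ ·.×-congʳ (suc n) (*-identityˡ y) ⟨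
      suc n · (1# * y)         ≈⟨ ·.×-assoc-* (suc n) 1# y ⟨
      (suc n · 1#) * y         ≈⟨ *-congʳ (HeytingProperties.x-0≈x heytingCommutativeRing _) ⟨
      (suc n · 1# - 0#) * y    ≈⟨ v*y≈1 ⟩
      1#                       ∎)
      where open SetoidReasoning setoid

  1/_ : ∀ n .{{_ : NonZero n}} → Carrier
  1/ n = proj₁ (inverse n)

  n·1/n≈1 : ∀ n .{{_ : NonZero n}} → n · (1/ n) ≈ 1#
  n·1/n≈1 n = proj₂ (inverse n)

  maximum : ∀ {m} .{{_ : NonZero m}} → Vector Carrier m → Carrier
  maximum {suc zero}    v = head v
  maximum {suc (suc m)} v = head v ⊔ maximum (tail v)

record IncidenceStructure (v b : ℕ) : Set₁ where
  infix 4 _on_ _on?_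
  field
    _on_  : Fin v → Fin b → Set
    _on?_ : Decidable _on_

  pointsOn : Fin b → ℕ
  pointsOn l = count (_on? l) (allFin v)

  linesThrough : Fin v → ℕ
  linesThrough p = count (p on?_) (allFin b)

record ProjectivePlane (n : ℕ) : Set₁ where
  field
    incidence : IncidenceStructure (n ℕ.^ 2 ℕ.+ n ℕ.+ 1) (n ℕ.^ 2 ℕ.+ n ℕ.+ 1)
  open IncidenceStructure incidence public
  field
    join          : ∀ p q → p ≢ q → ∃! _≡_ λ l → p on l × q on l
    meet          : ∀ k l → k ≢ l → ∃! _≡_ λ p → p on k × p on l
    pointsOn≡     : ∀ l → pointsOn l ≡ n ℕ.+ 1
    linesThrough≡ : ∀ p → linesThrough p ≡ n ℕ.+ 1

record AffinePlane (n : ℕ) : Set₁ where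
  field
    incidence : IncidenceStructure (n ℕ.^ 2) (n ℕ.^ 2 ℕ.+ n)
  open IncidenceStructure incidence public
  field
    join          : ∀ p q → p ≢ q → ∃! _≡_ λ l → p on l × q on l
    pointsOn≡     : ∀ l → pointsOn l ≡ n
    linesThrough≡ : ∀ p → linesThrough p ≡ n ℕ.+ 1

n²+n+1≢0 : ∀ n → NonZero (n ℕ.^ 2 ℕ.+ n ℕ.+ 1)
n²+n+1≢0 n = ℕ.>-nonZero (m≤n+m 1 (n ℕ.^ 2 ℕ.+ n))

n²+n≢0 : ∀ n .{{_ : NonZero n}} → NonZero (n ℕ.^ 2 ℕ.+ n)
n²+n≢0 n = ℕ.>-nonZero (+-mono-≤ {0} {n ℕ.^ 2} z≤n (ℕ.>-nonZero⁻¹ n))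

module _ {c ℓ₁ ℓ₂} (F : OrderedField c ℓ₁ ℓ₂) where
  open OrderedField F

  -- The number x of data groups is automatically positive: the empty sum
  -- is not 1#.
  record DataDistribution (m x : ℕ) : Set (c Level.⊔ ℓ₁ Level.⊔ ℓ₂) where
    field
      D    : Fin m → Fin x → Fin 2
      s    : Vector Carrier x
      s≥0  : ∀ j → 0# ≤ s j
      ∑s≈1 : sum s ≈ 1#

    DᵀD : Fin x → Fin x → ℕ
    DᵀD j k = ∑ℕ (λ i → toℕ (D i j) ℕ.* toℕ (D i k))
      where open SemiringSum ℕ.+-*-semiring using () renaming (sum to ∑ℕ)

    Ds : Vector Carrier m
    Ds i = ∑[ j < x ] (toℕ (D i j) · s j)

  open DataDistribution

  IsATAC : ∀ {m x} → DataDistribution m x → Set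
  IsATAC d = ∀ j k → DᵀD d j k ≢ 0

  L : ∀ {m x} .{{_ : NonZero m}} → DataDistribution m x → Carrier
  L d = maximum (Ds d)

  IsLmin : ∀ m .{{_ : NonZero m}} → Carrier → Set (c Level.⊔ ℓ₁ Level.⊔ ℓ₂)
  IsLmin m ℓ =
    (∃[ x ] ∃ λ (d : DataDistribution m x) → IsATAC d × L d ≈ ℓ) ×
    (∀ {x} (d : DataDistribution m x) → IsATAC d → ℓ ≤ L d)

  -- The number of unordered pairs of distinct data items with one item in
  -- group j and the other in group k, where group g has a g items.  Every
  -- unordered pair of groups is accounted for at the position with j ≤ k.
  comparisons : ∀ {x} → Vector Carrier x → Fin x → Fin x → Carrier
  comparisons a j k with <-cmp j k
  ... | tri< _ _ _ = a j * a k
  ... | tri≈ _ _ _ = a j * (a j - 1#) * (1/ 2)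
  ... | tri> _ _ _ = 0#

  -- A schedule for N data items in total.  Since rounding is neglected,
  -- N · s j need not be an integer, and neither need the amounts of
  -- comparisons assigned to the machines; amount i j k is the amount of
  -- comparisons between groups j and k done by machine i.
  record Schedule {m x} (d : DataDistribution m x) (N : ℕ)
         : Set (c Level.⊔ ℓ₁ Level.⊔ ℓ₂) where
    field
      amount    : Fin m → Fin x → Fin x → Carrier
      amount≥0  : ∀ i j k → 0# ≤ amount i j k
      onHolders : ∀ i j k → ¬ (D d i j ≡ 1F × D d i k ≡ 1F) → amount i j k ≈ 0#
      complete  : ∀ j k → ∑[ i < m ] amount i j k ≈ comparisons (λ g → N · s d g) j k

    load : Vector Carrier m
    load i = ∑[ j < x ] ∑[ k < x ] amount i j k

  -- The hypothesis on N makes the data set large enough for each group to be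
  -- empty or to hold at least one item; with a fraction of an item, the number
  -- a (a - 1) / 2 of comparisons inside a group would be negative.
  CanBeLoadBalanced : ∀ {m x} → DataDistribution m x → Set (c Level.⊔ ℓ₁ Level.⊔ ℓ₂)
  CanBeLoadBalanced d =
    ∀ N → (∀ j → s d j ≈ 0# ⊎ 1# ≤ N · s d j) →
    ∃ λ (σ : Schedule d N) → let open Schedule σ in ∀ i i′ → load i ≈ load i′

  private
    module < = IsStrictPartialOrder <-isStrictPartialOrder

    1/n≥0 : ∀ n .{{_ : NonZero n}} → 0# ≤ 1/ n
    1/n≥0 n@(suc k) y<0 = <.irrefl refl (<.trans 0<1 (<.<-respˡ-≈ (n·1/n≈1 n) (neg k)))
      where
      y = 1/ n
      neg : ∀ k → suc k · y < 0#
      neg zero    = <.<-respˡ-≈ (sym (+-identityʳ y)) y<0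
      neg (suc k) = <.trans (+-monoˡ-< (suc k · y) y<0)
                      (<.<-respˡ-≈ (sym (+-identityˡ _)) (neg k))

  derived : ∀ {v b} .{{_ : NonZero v}} → IncidenceStructure v b → DataDistribution b v
  derived {v} I = record
    { D    = D′
    ; s    = λ _ → 1/ v
    ; s≥0  = λ _ → 1/n≥0 v
    ; ∑s≈1 = trans (SemiringSum.sum-replicate semiring v) (n·1/n≈1 v)
    }
    where
    open IncidenceStructure I
    D′ : Fin _ → Fin v → Fin 2
    D′ l p with p on? l
    ... | yes _ = 1F
    ... | no  _ = 0F

  derivedᴾ : ∀ {n} → ProjectivePlane n → DataDistribution (n ℕ.^ 2 ℕ.+ n ℕ.+ 1) (n ℕ.^ 2 ℕ.+ n ℕ.+ 1)
  derivedᴾ {n} P = derived {{n²+n+1≢0 n}} (ProjectivePlane.incidence P)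

  derivedᴬ : ∀ {n} .{{_ : NonZero n}} → AffinePlane n → DataDistribution (n ℕ.^ 2 ℕ.+ n) (n ℕ.^ 2)
  derivedᴬ {n} A = derived {{m^n≢0 n 2}} (AffinePlane.incidence A)

{-# OPTIONS --safe #-}

-- In an ATAC distribution the machines holding a group j together hold all
-- data, so r_j · L ≥ 1, where r_j is the number of these machines.  If ℓ
-- satisfies n · ℓ ≤ 1, then L < ℓ forces r_j ≥ n + 1 for all j, and double
-- counting gives m · L ≥ Σ r_j · s_j ≥ n + 1.  Hence L ≥ ℓ whenever moreover
-- m · ℓ = n + 1; both kinds of planes attain such a value ℓ.
--
-- For the load balance, a comparison between different groups goes to the
-- unique line through the two points, and the comparisons within a group are
-- shared equally by the lines through its point.  All lines have the same
-- number of points, hence also the same number of pairs of points.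
module Submission where

open import Defs
import Algebra.Apartness.Properties.HeytingCommutativeRing as HeytingProperties
open import Algebra.Bundles using (CommutativeRing)
import Algebra.Properties.CommutativeMonoid.Mult as CommutativeMonoidMult
import Algebra.Properties.Semiring.Mult as SemiringMult
import Algebra.Properties.Semiring.Sum as SemiringSum
open import Data.Fin.Base using (Fin; zero; suc; toℕ)
open import Data.Fin.Patterns using (1F)
open import Data.Fin.Properties using (<-cmp)
open import Data.Nat.Base as ℕ using (ℕ; zero; suc; NonZero; z≤n; s≤s)
import Data.Nat.Properties as ℕ
open import Data.Nat.Tactic.RingSolver using (solve-∀)
open import Data.Product.Base using (_×_; _,_; proj₁; proj₂)
open import Data.Product using (∃!)
open import Data.Sum.Base using (_⊎_; inj₁; inj₂)
open import Data.Vec.Base using (count; tabulate)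
open import Data.Vec.Functional using (Vector)
open import Function.Base using (_∘_; _$_; id)
open import Relation.Binary.Definitions using (tri<; tri≈; tri>)
open import Relation.Binary.PropositionalEquality as ≡ using (_≡_; _≢_)
import Relation.Binary.Reasoning.Base.Triple as TripleReasoning
import Relation.Binary.Reasoning.Setoid as SetoidReasoning
open import Relation.Binary.Structures using (IsPreorder; IsStrictPartialOrder)
open import Relation.Nullary.Decidable using (Dec; yes; no)
open import Relation.Nullary.Negation using (¬_; contradiction)
open import Relation.Unary using (Pred; Decidable)

-- Finite sums of natural numbers and counting of ordered pairs.

module ℕΣ = SemiringSum ℕ.+-*-semiring
open ℕΣ using () renaming (sum to ∑ℕ)

sum-concentrated : ∀ {n} (f : Fin n → ℕ) i → (∀ j → j ≢ i → f j ≡ 0) → ∑ℕ f ≡ f i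
sum-concentrated {suc n} f zero f≡0 = begin
  f zero ℕ.+ ∑ℕ (f ∘ suc)  ≡⟨ ≡.cong (f zero ℕ.+_) (ℕΣ.sum-cong-≗ (λ j → f≡0 (suc j) λ ())) ⟩
  f zero ℕ.+ ∑ℕ {n} (λ _ → 0)  ≡⟨ ≡.cong (f zero ℕ.+_) (ℕΣ.sum-replicate-zero n) ⟩
  f zero ℕ.+ 0             ≡⟨ ℕ.+-identityʳ _ ⟩
  f zero                   ∎
  where open ≡.≡-Reasoning
sum-concentrated f (suc i) f≡0 = begin
  f zero ℕ.+ ∑ℕ (f ∘ suc)  ≡⟨ ≡.cong (ℕ._+ ∑ℕ (f ∘ suc)) (f≡0 zero λ ()) ⟩
  ∑ℕ (f ∘ suc)             ≡⟨ sum-concentrated (f ∘ suc) i (λ j j≢i → f≡0 (suc j) λ { ≡.refl → j≢i ≡.refl }) ⟩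
  f (suc i)                ∎
  where open ≡.≡-Reasoning

indicator : ∀ {a} {A : Set a} → Dec A → ℕ
indicator (yes _) = 1
indicator (no  _) = 0

count-tabulate : ∀ {a p} {A : Set a} {P : Pred A p} (P? : Decidable P) {n} (f : Fin n → A) →
                 count P? (tabulate f) ≡ ∑ℕ (λ i → indicator (P? (f i)))
count-tabulate P? {zero}  f = ≡.refl
count-tabulate P? {suc n} f with P? (f zero)
... | yes _ = ≡.cong suc (count-tabulate P? (f ∘ suc))
... | no  _ = count-tabulate P? (f ∘ suc)

-- Both split on `<-cmp` exactly as `comparisons` does, so that a single match on it later evaluates
-- all three.
δ< δ≡ : ∀ {n} → Fin n → Fin n → ℕ
δ< j k with <-cmp j k
... | tri< _ _ _ = 1
... | tri≈ _ _ _ = 0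
... | tri> _ _ _ = 0
δ≡ j k with <-cmp j k
... | tri< _ _ _ = 0
... | tri≈ _ _ _ = 1
... | tri> _ _ _ = 0

δ≡-refl : ∀ {n} (j : Fin n) → δ≡ j j ≡ 1
δ≡-refl j with <-cmp j j
... | tri< _ j≢j _ = contradiction ≡.refl j≢j
... | tri≈ _ _   _ = ≡.refl
... | tri> _ j≢j _ = contradiction ≡.refl j≢j

δ≡-≢ : ∀ {n} {j k : Fin n} → j ≢ k → δ≡ j k ≡ 0
δ≡-≢ {j = j} {k} j≢k with <-cmp j k
... | tri< _ _   _ = ≡.refl
... | tri≈ _ j≡k _ = contradiction j≡k j≢k
... | tri> _ _   _ = ≡.refl

δ-trichotomy : ∀ {n} (j k : Fin n) → δ< j k ℕ.+ δ< k j ℕ.+ δ≡ j k ≡ 1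
δ-trichotomy j k with <-cmp j k | <-cmp k j
... | tri< _ _ _   | tri> _ _ _   = ≡.refl
... | tri≈ _ _ _   | tri≈ _ _ _   = ≡.refl
... | tri> _ _ _   | tri< _ _ _   = ≡.refl
-- The type checker sees no link between the two calls of `<-cmp`, so the six combinations that
-- disagree are refuted one by one.
... | tri< j<k _ _ | tri< _ _ k≯j = contradiction j<k k≯j
... | tri< _ j≢k _ | tri≈ _ k≡j _ = contradiction (≡.sym k≡j) j≢k
... | tri≈ _ j≡k _ | tri< _ k≢j _ = contradiction (≡.sym j≡k) k≢j
... | tri≈ _ j≡k _ | tri> _ k≢j _ = contradiction (≡.sym j≡k) k≢j
... | tri> _ j≢k _ | tri≈ _ k≡j _ = contradiction (≡.sym k≡j) j≢k
... | tri> _ _ j>k | tri> k≮j _ _ = contradiction j>k k≮j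

∑∑-δ≡ : ∀ {n} (e : Fin n → ℕ) →
        ∑ℕ (λ j → ∑ℕ λ k → e j ℕ.* e k ℕ.* δ≡ j k) ≡ ∑ℕ (λ j → e j ℕ.* e j)
∑∑-δ≡ e = ℕΣ.sum-cong-≗ λ j → ≡.trans
  (sum-concentrated _ j λ k k≢j →
    ≡.trans (≡.cong (e j ℕ.* e k ℕ.*_) (δ≡-≢ (k≢j ∘ ≡.sym))) (ℕ.*-zeroʳ (e j ℕ.* e k)))
  (≡.trans (≡.cong (e j ℕ.* e j ℕ.*_) (δ≡-refl j)) (ℕ.*-identityʳ _))

-- Expanding the square gives a sum over all ordered pairs. By trichotomy it splits into the pairs
-- below, above and on the diagonal, and exchanging the indices identifies the first two parts.
sum-square : ∀ {n} (e : Fin n → ℕ) →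
             2 ℕ.* ∑ℕ (λ j → ∑ℕ λ k → e j ℕ.* e k ℕ.* δ< j k) ℕ.+ ∑ℕ (λ j → e j ℕ.* e j)
             ≡ ∑ℕ e ℕ.* ∑ℕ e
sum-square {n} e = begin
  2 ℕ.* ∑∑ A ℕ.+ ∑ℕ (λ j → e j ℕ.* e j)    ≡⟨ ≡.cong₂ ℕ._+_ 2A (≡.sym (∑∑-δ≡ e)) ⟩
  ∑∑ A ℕ.+ ∑∑ B ℕ.+ ∑∑ C                    ≡⟨ ≡.cong (ℕ._+ ∑∑ C) (∑∑-+ A B) ⟨
  ∑∑ (λ j k → A j k ℕ.+ B j k) ℕ.+ ∑∑ C     ≡⟨ ∑∑-+ (λ j k → A j k ℕ.+ B j k) C ⟨
  ∑∑ (λ j k → A j k ℕ.+ B j k ℕ.+ C j k)    ≡⟨ (ℕΣ.sum-cong-≗ λ j → ℕΣ.sum-cong-≗ λ k → pointwise j k) ⟩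
  ∑∑ (λ j k → e j ℕ.* e k)                  ≡⟨ (ℕΣ.sum-cong-≗ λ j → ℕΣ.*-distribˡ-sum (e j) e) ⟨
  ∑ℕ (λ j → e j ℕ.* ∑ℕ e)                   ≡⟨ ℕΣ.*-distribʳ-sum (∑ℕ e) e ⟨
  ∑ℕ e ℕ.* ∑ℕ e                             ∎
  where
  open ≡.≡-Reasoning
  ∑∑ : (Fin n → Fin n → ℕ) → ℕ
  ∑∑ f = ∑ℕ λ j → ∑ℕ (f j)

  A B C : Fin n → Fin n → ℕ
  A j k = e j ℕ.* e k ℕ.* δ< j k
  B j k = e k ℕ.* e j ℕ.* δ< k j
  C j k = e j ℕ.* e k ℕ.* δ≡ j k

  2A : 2 ℕ.* ∑∑ A ≡ ∑∑ A ℕ.+ ∑∑ B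
  2A = ≡.cong (∑∑ A ℕ.+_) (≡.trans (ℕ.+-identityʳ _) (ℕΣ.∑-comm A))

  ∑∑-+ : ∀ f g → ∑∑ (λ j k → f j k ℕ.+ g j k) ≡ ∑∑ f ℕ.+ ∑∑ g
  ∑∑-+ f g = ≡.trans (ℕΣ.sum-cong-≗ λ j → ℕΣ.∑-distrib-+ (f j) (g j)) (ℕΣ.∑-distrib-+ (∑ℕ ∘ f) (∑ℕ ∘ g))

  factor : ∀ a b x y z →
           a ℕ.* b ℕ.* x ℕ.+ b ℕ.* a ℕ.* y ℕ.+ a ℕ.* b ℕ.* z ≡ a ℕ.* b ℕ.* (x ℕ.+ y ℕ.+ z)
  factor = solve-∀

  pointwise : ∀ j k → A j k ℕ.+ B j k ℕ.+ C j k ≡ e j ℕ.* e k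
  pointwise j k = ≡.trans (factor (e j) (e k) (δ< j k) (δ< k j) (δ≡ j k))
    (≡.trans (≡.cong (e j ℕ.* e k ℕ.*_) (δ-trichotomy j k)) (ℕ.*-identityʳ _))

-- Order, natural multiples and finite sums in an ordered field.

module OrderedFieldProperties {c ℓ₁ ℓ₂} (F : OrderedField c ℓ₁ ℓ₂) where
  open OrderedField F hiding (zero)
  open IsStrictPartialOrder <-isStrictPartialOrder public
    using (<-resp-≈; <-respˡ-≈; <-respʳ-≈)
    renaming (irrefl to <-irrefl; trans to <-trans; asym to <-asym)
  open CommutativeRing commutativeRing using (+-commutativeMonoid)
  open HeytingProperties heytingCommutativeRing using (x-0≈x; invertibleˡ⇒#)
  open SemiringSum semiring public
    using (sum-cong-≋; sum-replicate; sum-replicate-zero; ∑-comm; ∑-distrib-+)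
  open SemiringMult semiring public
    using () renaming (×-congʳ to ·-congʳ; ×-congˡ to ·-congˡ; ×-assocˡ to ·-assocˡ; ×-homo-+ to ·-homo-+)
  open CommutativeMonoidMult +-commutativeMonoid public
    using () renaming (×-distrib-+ to ·-distrib-+)

  private variable
    x y z u : Carrier

  ≤-reflexive : x ≈ y → x ≤ y
  ≤-reflexive x≈y = <-irrefl (sym x≈y)

  <⇒≤ : x < y → x ≤ y
  <⇒≤ = <-asym

  -- As `_≤_` is a mere negation, the strict conclusion comes from cotransitivity of `_#_`: it
  -- separates `z` from `x` or from `y`, and every order other than the desired one is
  -- contradictory.
  <-≤-trans : x < y → y ≤ z → x < z
  <-≤-trans {z = z} x<y y≤z with #-cotrans (<⇒# x<y) z
  ... | inj₁ x#z with #⇒<⊎> x#z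
  ...   | inj₁ x<z = x<z
  ...   | inj₂ z<x = contradiction (<-trans z<x x<y) y≤z
  <-≤-trans {z = z} x<y y≤z | inj₂ z#y with #⇒<⊎> z#y
  ...   | inj₁ z<y = contradiction z<y y≤z
  ...   | inj₂ y<z = <-trans x<y y<z

  ≤-<-trans : x ≤ y → y < z → x < z
  ≤-<-trans {x} x≤y y<z with #-cotrans (<⇒# y<z) x
  ... | inj₂ x#z with #⇒<⊎> x#z
  ...   | inj₁ x<z = x<z
  ...   | inj₂ z<x = contradiction (<-trans y<z z<x) x≤y
  ≤-<-trans {x} x≤y y<z | inj₁ y#x with #⇒<⊎> y#x
  ...   | inj₁ y<x = contradiction y<x x≤y
  ...   | inj₂ x<y = <-trans x<y y<z

  ≤-trans : x ≤ y → y ≤ z → x ≤ z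
  ≤-trans x≤y y≤z z<x = y≤z (<-≤-trans z<x x≤y)

  ≤-antisym : x ≤ y → y ≤ x → x ≈ y
  ≤-antisym {x} {y} x≤y y≤x = proj₁ (tight x y) λ x#y → case (#⇒<⊎> x#y)
    where
    case : ¬ (x < y ⊎ y < x)
    case (inj₁ x<y) = y≤x x<y
    case (inj₂ y<x) = x≤y y<x

  ≤-isPreorder : IsPreorder _≈_ _≤_
  ≤-isPreorder = record { isEquivalence = isEquivalence ; reflexive = ≤-reflexive ; trans = ≤-trans }

  module ≤-Reasoning = TripleReasoning ≤-isPreorder
    <-asym <-trans <-resp-≈ <⇒≤ <-≤-trans ≤-<-trans

  +-cancelʳ-< : ∀ z → x + z < y + z → x < y
  +-cancelʳ-< z p = <-respˡ-≈ (lemma _) (<-respʳ-≈ (lemma _) (+-monoˡ-< (- z) p))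
    where
    lemma : ∀ x → x + z - z ≈ x
    lemma x = trans (+-assoc x z (- z)) (trans (+-congˡ (-‿inverseʳ z)) (+-identityʳ x))

  +-monoˡ-≤ : ∀ z → x ≤ y → x + z ≤ y + z
  +-monoˡ-≤ z x≤y = x≤y ∘ +-cancelʳ-< z

  +-mono-≤ : x ≤ y → z ≤ u → x + z ≤ y + u
  +-mono-≤ {x} {y} {z} {u} x≤y z≤u = begin
    x + z  ≤⟨ +-monoˡ-≤ z x≤y ⟩
    y + z  ≈⟨ +-comm y z ⟩
    z + y  ≤⟨ +-monoˡ-≤ y z≤u ⟩
    u + y  ≈⟨ +-comm u y ⟩
    y + u  ∎
    where open ≤-Reasoning

  +-nonNegative : 0# ≤ x → 0# ≤ y → 0# ≤ x + y
  +-nonNegative 0≤x 0≤y = ≤-trans (≤-reflexive (sym (+-identityˡ 0#))) (+-mono-≤ 0≤x 0≤y)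

  -- It cannot be decided whether a factor is zero or positive. But a negative product would be
  -- invertible, hence so would both factors; they would then be apart from zero, thus positive, and
  -- so would be their product.
  *-nonNegative : 0# ≤ x → 0# ≤ y → 0# ≤ x * y
  *-nonNegative {x} {y} 0≤x 0≤y xy<0 with #⇒invertible (<⇒# xy<0)
  ... | z , z[xy-0]≈1 , _ = <-asym xy<0 (*-pos (positive 0≤x x#0) (positive 0≤y y#0))
    where
    open SetoidReasoning setoid
    positive : ∀ {a} → 0# ≤ a → a # 0# → 0# < a
    positive 0≤a a#0 with #⇒<⊎> a#0
    ... | inj₁ a<0 = contradiction a<0 0≤a
    ... | inj₂ 0<a = 0<a

    z[xy]≈1 : z * (x * y) ≈ 1#
    z[xy]≈1 = trans (*-congˡ (sym (x-0≈x (x * y)))) z[xy-0]≈1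

    x#0 : x # 0#
    x#0 = invertibleˡ⇒# $ z * y , (begin
      z * y * (x - 0#)  ≈⟨ *-congˡ (x-0≈x x) ⟩
      z * y * x         ≈⟨ *-assoc z y x ⟩
      z * (y * x)       ≈⟨ *-congˡ (*-comm y x) ⟩
      z * (x * y)       ≈⟨ z[xy]≈1 ⟩
      1#                ∎)

    y#0 : y # 0#
    y#0 = invertibleˡ⇒# $ z * x , (begin
      z * x * (y - 0#)  ≈⟨ *-congˡ (x-0≈x y) ⟩
      z * x * y         ≈⟨ *-assoc z x y ⟩
      z * (x * y)       ≈⟨ z[xy]≈1 ⟩
      1#                ∎)

  ·-zeroʳ : ∀ n → n · 0# ≈ 0#
  ·-zeroʳ n = trans (sym (sum-replicate n)) (sum-replicate-zero n)

  ·-monoʳ-≤ : ∀ n → x ≤ y → n · x ≤ n · y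
  ·-monoʳ-≤ zero    x≤y = <-irrefl refl
  ·-monoʳ-≤ (suc n) x≤y = +-mono-≤ x≤y (·-monoʳ-≤ n x≤y)

  ·-monoʳ-< : ∀ n .{{_ : NonZero n}} → x < y → n · x < n · y
  ·-monoʳ-< {x} {y} (suc n) x<y =
    <-≤-trans (+-monoˡ-< (n · x) x<y) (+-mono-≤ (<-irrefl refl) (·-monoʳ-≤ n (<⇒≤ x<y)))

  ·-monoˡ-≤ : ∀ {m n} → 0# ≤ x → m ℕ.≤ n → m · x ≤ n · x
  ·-monoˡ-≤ {n = zero}  0≤x z≤n       = <-irrefl refl
  ·-monoˡ-≤ {n = suc n} 0≤x z≤n       = +-nonNegative 0≤x (·-monoˡ-≤ {n = n} 0≤x z≤n)
  ·-monoˡ-≤             0≤x (s≤s m≤n) = +-mono-≤ (<-irrefl refl) (·-monoˡ-≤ 0≤x m≤n)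

  ·-nonNegative : ∀ n → 0# ≤ x → 0# ≤ n · x
  ·-nonNegative n 0≤x = ·-monoˡ-≤ {n = n} 0≤x z≤n

  1/n-nonNegative : ∀ n .{{_ : NonZero n}} → 0# ≤ 1/ n
  1/n-nonNegative n 1/n<0 = <-asym 0<1
    (<-respˡ-≈ (n·1/n≈1 n) (<-respʳ-≈ (·-zeroʳ n) (·-monoʳ-< n 1/n<0)))

  sum-mono-≤ : ∀ {n} {f g : Vector Carrier n} → (∀ i → f i ≤ g i) → sum f ≤ sum g
  sum-mono-≤ {zero}  f≤g = <-irrefl refl
  sum-mono-≤ {suc n} f≤g = +-mono-≤ (f≤g zero) (sum-mono-≤ (f≤g ∘ suc))

  -- This carries counts of incidences over to amounts in the field.
  ∑ℕ-· : ∀ {n} (f : Fin n → ℕ) x → ∑ℕ f · x ≈ ∑[ i < n ] (f i · x)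
  ∑ℕ-· {zero}  f x = refl
  ∑ℕ-· {suc n} f x = trans (·-homo-+ x (f zero) _) (+-congˡ (∑ℕ-· (f ∘ suc) x))

  ·-sum : ∀ {n} m (f : Vector Carrier n) → m · sum f ≈ ∑[ i < n ] (m · f i)
  ·-sum {zero}  m f = ·-zeroʳ m
  ·-sum {suc n} m f = trans (·-distrib-+ _ _ m) (+-congˡ (·-sum m (f ∘ suc)))

  ≤-maximum : ∀ {m} .{{_ : NonZero m}} (f : Vector Carrier m) i → f i ≤ maximum f
  ≤-maximum {suc zero}    f zero    = <-irrefl refl
  ≤-maximum {suc (suc m)} f zero    = proj₁ (⊔-supremum _ _)
  ≤-maximum {suc (suc m)} f (suc i) =
    ≤-trans (≤-maximum (f ∘ suc) i) (proj₁ (proj₂ (⊔-supremum _ _)))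

  maximum-≤ : ∀ {m} .{{_ : NonZero m}} (f : Vector Carrier m) → (∀ i → f i ≤ x) → maximum f ≤ x
  maximum-≤ {m = suc zero}    f f≤x = f≤x zero
  maximum-≤ {m = suc (suc m)} f f≤x =
    proj₂ (proj₂ (⊔-supremum _ _)) _ (f≤x zero) (maximum-≤ (f ∘ suc) (f≤x ∘ suc))

  maximum-constant : ∀ {m} .{{_ : NonZero m}} (f : Vector Carrier m) →
                     (∀ i → f i ≈ x) → maximum f ≈ x
  maximum-constant {m = suc m} f f≈x = ≤-antisym
    (maximum-≤ f (≤-reflexive ∘ f≈x))
    (≤-trans (≤-reflexive (sym (f≈x zero))) (≤-maximum f zero))

module _ {c ℓ₁ ℓ₂} (F : OrderedField c ℓ₁ ℓ₂) where
  open OrderedField F hiding (zero)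
  open OrderedFieldProperties F

  -- The lower bound on the storage limit of an ATAC distribution.

  module StorageBound {m x} .{{_ : NonZero m}} (d : DataDistribution F m x) (atac : IsATAC F d) where
    open DataDistribution d

    holders : Fin x → ℕ
    holders j = ∑ℕ λ i → toℕ (D i j)

    -- Some machine holding `j` also holds `k`, so every `s k` is counted at least once. After
    -- exchanging the sums, the machines without `j` have coefficient 0 and each of the others
    -- contributes at most `L F d`.
    1≤holders·L : ∀ j → 1# ≤ holders j · L F d
    1≤holders·L j = begin
      1#                                                                ≈⟨ ∑s≈1 ⟨
      sum s                                                             ≤⟨ sum-mono-≤ s≤ ⟩
      ∑[ k < x ] (DᵀD j k · s k)                                        ≈⟨ sum-cong-≋ (λ k → ∑ℕ-· (λ i → toℕ (D i j) ℕ.* toℕ (D i k)) (s k)) ⟩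
      ∑[ k < x ] ∑[ i < m ] ((toℕ (D i j) ℕ.* toℕ (D i k)) · s k)       ≈⟨ ∑-comm (λ k i → (toℕ (D i j) ℕ.* toℕ (D i k)) · s k) ⟩
      ∑[ i < m ] ∑[ k < x ] ((toℕ (D i j) ℕ.* toℕ (D i k)) · s k)       ≈⟨ sum-cong-≋ (λ i → sum-cong-≋ λ k → sym (·-assocˡ (s k) (toℕ (D i j)) (toℕ (D i k)))) ⟩
      ∑[ i < m ] ∑[ k < x ] (toℕ (D i j) · (toℕ (D i k) · s k))         ≈⟨ sum-cong-≋ (λ i → sym (·-sum (toℕ (D i j)) (λ k → toℕ (D i k) · s k))) ⟩
      ∑[ i < m ] (toℕ (D i j) · Ds i)                                   ≤⟨ sum-mono-≤ (λ i → ·-monoʳ-≤ (toℕ (D i j)) (≤-maximum Ds i)) ⟩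
      ∑[ i < m ] (toℕ (D i j) · L F d)                                  ≈⟨ ∑ℕ-· (λ i → toℕ (D i j)) (L F d) ⟨
      holders j · L F d                                                 ∎
      where
      open ≤-Reasoning
      s≤ : ∀ k → s k ≤ DᵀD j k · s k
      s≤ k = ≤-trans (≤-reflexive (sym (+-identityʳ (s k))))
        (·-monoˡ-≤ {m = 1} {n = DᵀD j k} (s≥0 k) (ℕ.n≢0⇒n>0 (atac j k)))

    -- The stored data are counted once by groups and once by machines.
    ∑holders·s≤m·L : ∑[ j < x ] (holders j · s j) ≤ m · L F d
    ∑holders·s≤m·L = begin
      ∑[ j < x ] (holders j · s j)                    ≈⟨ sum-cong-≋ (λ j → ∑ℕ-· (λ i → toℕ (D i j)) (s j)) ⟩
      ∑[ j < x ] ∑[ i < m ] (toℕ (D i j) · s j)       ≈⟨ ∑-comm (λ j i → toℕ (D i j) · s j) ⟩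
      sum Ds                                          ≤⟨ sum-mono-≤ (≤-maximum Ds) ⟩
      ∑[ i < m ] L F d                                ≈⟨ sum-replicate m ⟩
      m · L F d                                       ∎
      where open ≤-Reasoning

    -- The conclusion is by definition the refutation of `L F d < ℓ`, so arguing by contradiction is
    -- constructive here.
    lower-bound : ∀ n {ℓ} → 0# ≤ ℓ → n · ℓ ≤ 1# → m · ℓ ≈ suc n · 1# → ℓ ≤ L F d
    lower-bound n {ℓ} 0≤ℓ n·ℓ≤1 m·ℓ≈n+1 L<ℓ = <-irrefl refl (begin-strict
      suc n · 1#                       ≈⟨ ·-congʳ (suc n) ∑s≈1 ⟨
      suc n · sum s                    ≈⟨ ·-sum (suc n) s ⟩
      ∑[ j < x ] (suc n · s j)         ≤⟨ sum-mono-≤ (λ j → ·-monoˡ-≤ (s≥0 j) (n<holders j)) ⟩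
      ∑[ j < x ] (holders j · s j)     ≤⟨ ∑holders·s≤m·L ⟩
      m · L F d                        <⟨ ·-monoʳ-< m L<ℓ ⟩
      m · ℓ                            ≈⟨ m·ℓ≈n+1 ⟩
      suc n · 1#                       ∎)
      where
      open ≤-Reasoning
      small : ∀ r → r ℕ.≤ n → ¬ (1# ≤ r · L F d)
      -- Zero is separate because multiplication by `r` keeps `L F d < ℓ` strict only for nonzero
      -- `r`.
      small zero    _   1≤0   = 1≤0 0<1
      small (suc r) r≤n 1≤r·L = <-irrefl refl (begin-strict
        1#             ≤⟨ 1≤r·L ⟩
        suc r · L F d  <⟨ ·-monoʳ-< (suc r) L<ℓ ⟩
        suc r · ℓ      ≤⟨ ·-monoˡ-≤ 0≤ℓ r≤n ⟩
        n · ℓ          ≤⟨ n·ℓ≤1 ⟩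
        1#             ∎)

      n<holders : ∀ j → n ℕ.< holders j
      -- These are natural numbers, so refuting `holders j ≤ n` yields a strict inequality.
      n<holders j = ℕ.≰⇒> λ h≤n → small (holders j) h≤n (1≤holders·L j)

  -- Designs with one line through any two points, covering both kinds of planes.

  module Design
    {v b} .{{_ : NonZero v}} .{{_ : NonZero b}} (I : IncidenceStructure v b)
    (join : ∀ p q → p ≢ q → ∃! _≡_ λ l → IncidenceStructure._on_ I p l × IncidenceStructure._on_ I q l)
    (k n : ℕ)
    (pointsOn≡ : ∀ l → IncidenceStructure.pointsOn I l ≡ k)
    (linesThrough≡ : ∀ p → IncidenceStructure.linesThrough I p ≡ suc n)
    where
    open IncidenceStructure I using (_on_; _on?_)

    d : DataDistribution F b v
    d = derived F I

    open DataDistribution d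

    e : Fin b → Fin v → ℕ
    e l p = toℕ (D l p)

    e≡indicator : ∀ l p → e l p ≡ indicator (p on? l)
    e≡indicator l p with p on? l
    ... | yes _ = ≡.refl
    ... | no  _ = ≡.refl

    e-on : ∀ {l p} → p on l → e l p ≡ 1
    e-on {l} {p} p∈l with p on? l
    ... | yes _  = ≡.refl
    ... | no p∉l = contradiction p∈l p∉l

    e-off : ∀ {l p} → ¬ (p on l) → e l p ≡ 0
    e-off {l} {p} p∉l with p on? l
    ... | yes p∈l = contradiction p∈l p∉l
    ... | no  _   = ≡.refl

    D-on : ∀ {l p} → p on l → D l p ≡ 1F
    D-on {l} {p} p∈l with p on? l
    ... | yes _  = ≡.refl
    ... | no p∉l = contradiction p∈l p∉l

    e² : ∀ l p → e l p ℕ.* e l p ≡ e l p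
    e² l p with p on? l
    ... | yes _ = ≡.refl
    ... | no  _ = ≡.refl

    ee-off : ∀ {l p q} → ¬ (p on l × q on l) → e l p ℕ.* e l q ≡ 0
    ee-off {l} {p} {q} ¬pq with p on? l
    ... | no  _   = ≡.refl
    ... | yes p∈l = ≡.trans (ℕ.+-identityʳ _) (e-off λ q∈l → ¬pq (p∈l , q∈l))

    ∑e≡k : ∀ l → ∑ℕ (e l) ≡ k
    ∑e≡k l = ≡.trans (ℕΣ.sum-cong-≗ (e≡indicator l))
      (≡.trans (≡.sym (count-tabulate (_on? l) id)) (pointsOn≡ l))

    -- Incidences are 0 or 1, so squaring changes nothing and the entry counts the lines through
    -- `p`.
    DᵀD-diagonal : ∀ p → DᵀD p p ≡ suc n
    DᵀD-diagonal p = ≡.trans (ℕΣ.sum-cong-≗ λ l → ≡.trans (e² l p) (e≡indicator l p))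
      (≡.trans (≡.sym (count-tabulate (p on?_) id)) (linesThrough≡ p))

    -- Uniqueness of the joining line leaves a single nonzero term, and its existence makes that
    -- term 1.
    DᵀD-offDiagonal : ∀ {p q} → p ≢ q → DᵀD p q ≡ 1
    DᵀD-offDiagonal {p} {q} p≢q with join p q p≢q
    ... | l , (p∈l , q∈l) , unique = ≡.trans
      (sum-concentrated _ l λ l′ l′≢l → ee-off λ pq∈l′ → l′≢l (≡.sym (unique pq∈l′)))
      (≡.cong₂ ℕ._*_ (e-on p∈l) (e-on q∈l))

    isATAC : IsATAC F d
    isATAC p q with <-cmp p q
    ... | tri< _ p≢q _    = λ eq → contradiction (≡.trans (≡.sym (DᵀD-offDiagonal p≢q)) eq) λ ()
    ... | tri≈ _ ≡.refl _ = λ eq → contradiction (≡.trans (≡.sym (DᵀD-diagonal p)) eq) λ ()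
    ... | tri> _ p≢q _    = λ eq → contradiction (≡.trans (≡.sym (DᵀD-offDiagonal p≢q)) eq) λ ()

    L≈k/v : L F d ≈ k · (1/ v)
    L≈k/v = maximum-constant Ds λ l →
      trans (sym (∑ℕ-· (e l) (1/ v))) (·-congˡ (∑e≡k l))

    -- With ℓ = k / v, the hypotheses are the conditions b · ℓ = n + 1 and n · ℓ ≤ 1 of
    -- `lower-bound`, cleared of the denominator `v`. The first one is the double count of incident
    -- pairs.
    isLmin : b ℕ.* k ≡ suc n ℕ.* v → n ℕ.* k ℕ.≤ v → IsLmin F b (L F d)
    isLmin bk≡[n+1]v nk≤v = (v , d , isATAC , refl) , λ d′ atac →
      ≤-trans (≤-reflexive L≈k/v)
        (StorageBound.lower-bound d′ atac n (·-nonNegative k (1/n-nonNegative v)) n·k/v≤1 b·k/v≈n+1)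
      where
      n·k/v≤1 : n · (k · (1/ v)) ≤ 1#
      n·k/v≤1 = begin
        n · (k · (1/ v))    ≈⟨ ·-assocˡ (1/ v) n k ⟩
        (n ℕ.* k) · (1/ v)  ≤⟨ ·-monoˡ-≤ (1/n-nonNegative v) nk≤v ⟩
        v · (1/ v)          ≈⟨ n·1/n≈1 v ⟩
        1#                  ∎
        where open ≤-Reasoning

      b·k/v≈n+1 : b · (k · (1/ v)) ≈ suc n · 1#
      b·k/v≈n+1 = begin
        b · (k · (1/ v))        ≈⟨ ·-assocˡ (1/ v) b k ⟩
        (b ℕ.* k) · (1/ v)      ≈⟨ ·-congˡ bk≡[n+1]v ⟩
        (suc n ℕ.* v) · (1/ v)  ≈⟨ ·-assocˡ (1/ v) (suc n) v ⟨
        suc n · (v · (1/ v))    ≈⟨ ·-congʳ (suc n) (n·1/n≈1 v) ⟩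
        suc n · 1#              ∎
        where open SetoidReasoning setoid

    -- Twice this number is k (k - 1), so it is the same for all lines.
    pairsOn : Fin b → ℕ
    pairsOn l = ∑ℕ λ p → ∑ℕ λ q → e l p ℕ.* e l q ℕ.* δ< p q

    pairsOn-constant : ∀ l l′ → pairsOn l ≡ pairsOn l′
    -- Adding `k` to both sides avoids the truncated subtraction in k (k - 1).
    pairsOn-constant l l′ = ℕ.*-cancelˡ-≡ _ _ 2 (ℕ.+-cancelʳ-≡ k _ _ (≡.trans (square l) (≡.sym (square l′))))
      where
      square : ∀ l → 2 ℕ.* pairsOn l ℕ.+ k ≡ k ℕ.* k
      square l = ≡.trans
        (≡.cong (2 ℕ.* pairsOn l ℕ.+_) (≡.sym (≡.trans (ℕΣ.sum-cong-≗ (e² l)) (∑e≡k l))))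
        (≡.trans (sum-square (e l)) (≡.cong₂ ℕ._*_ (∑e≡k l) (∑e≡k l)))

    diagonalOn≡k : ∀ l → ∑ℕ (λ p → ∑ℕ λ q → e l p ℕ.* e l q ℕ.* δ≡ p q) ≡ k
    diagonalOn≡k l = ≡.trans (∑∑-δ≡ (e l)) (≡.trans (ℕΣ.sum-cong-≗ (e² l)) (∑e≡k l))

    -- The balanced schedule.

    module _ (N : ℕ) (large : ∀ p → s p ≈ 0# ⊎ 1# ≤ N · s p) where
      -- Here `a` is the number of items in a group, `α` the work for two different groups, and `β`
      -- the share of one of the `suc n` lines through a point in the work inside its group.
      a α β : Carrier
      a = N · (1/ v)
      α = a * a
      β = a * (a - 1#) * (1/ 2) * (1/ suc n)

      -- The incidence factors make the amount vanish off the holders. Since all coefficients are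
      -- natural numbers, summing over lines yields entries of `DᵀD`, and summing over pairs of
      -- points yields numbers that depend on the line alone.
      amount : Fin b → Fin v → Fin v → Carrier
      amount l p q = (e l p ℕ.* e l q ℕ.* δ< p q) · α + (e l p ℕ.* e l q ℕ.* δ≡ p q) · β

      1≤a : Fin v → 1# ≤ a
      1≤a p with large p
      ... | inj₂ 1≤a   = 1≤a
      -- No group is empty: `1/ v ≈ 0#` would collapse `v · (1/ v) ≈ 1#` to `0# ≈ 1#`.
      ... | inj₁ 1/v≈0 = λ _ → <-irrefl 0≈1 0<1
        where
        0≈1 : 0# ≈ 1#
        0≈1 = trans (sym (·-zeroʳ v)) (trans (·-congʳ v (sym 1/v≈0)) (n·1/n≈1 v))

      -- The sign of `β` hinges on its factor `a - 1#`, which is where the size hypothesis `large`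
      -- enters.
      amount≥0 : ∀ l p q → 0# ≤ amount l p q
      amount≥0 l p q = +-nonNegative
        (·-nonNegative (e l p ℕ.* e l q ℕ.* δ< p q) (*-nonNegative 0≤a 0≤a))
        (·-nonNegative (e l p ℕ.* e l q ℕ.* δ≡ p q)
          (*-nonNegative (*-nonNegative (*-nonNegative 0≤a 0≤a-1) (1/n-nonNegative 2))
            (1/n-nonNegative (suc n))))
        where
        0≤a : 0# ≤ a
        0≤a = ≤-trans (<⇒≤ 0<1) (1≤a p)
        0≤a-1 : 0# ≤ a - 1#
        0≤a-1 = ≤-trans (≤-reflexive (sym (-‿inverseʳ 1#))) (+-monoˡ-≤ (- 1#) (1≤a p))

      onHolders : ∀ l p q → ¬ (D l p ≡ 1F × D l q ≡ 1F) → amount l p q ≈ 0#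
      onHolders l p q ¬held = trans
        (+-cong (·-congˡ (≡.cong (ℕ._* δ< p q) ee≡0)) (·-congˡ (≡.cong (ℕ._* δ≡ p q) ee≡0)))
        (+-identityˡ 0#)
        where
        ee≡0 : e l p ℕ.* e l q ≡ 0
        ee≡0 = ee-off λ (p∈l , q∈l) → ¬held (D-on p∈l , D-on q∈l)

      ∑amount : ∀ p q → ∑[ l < b ] amount l p q ≈ (DᵀD p q ℕ.* δ< p q) · α + (DᵀD p q ℕ.* δ≡ p q) · β
      ∑amount p q = begin
        ∑[ l < b ] amount l p q
          ≈⟨ ∑-distrib-+ (λ l → (ee l ℕ.* δ< p q) · α) (λ l → (ee l ℕ.* δ≡ p q) · β) ⟩
        ∑[ l < b ] ((ee l ℕ.* δ< p q) · α) + ∑[ l < b ] ((ee l ℕ.* δ≡ p q) · β)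
          ≈⟨ +-cong (∑ℕ-· (λ l → ee l ℕ.* δ< p q) α) (∑ℕ-· (λ l → ee l ℕ.* δ≡ p q) β) ⟨
        ∑ℕ (λ l → ee l ℕ.* δ< p q) · α + ∑ℕ (λ l → ee l ℕ.* δ≡ p q) · β
          ≈⟨ +-cong (·-congˡ (ℕΣ.*-distribʳ-sum (δ< p q) ee)) (·-congˡ (ℕΣ.*-distribʳ-sum (δ≡ p q) ee)) ⟨
        (DᵀD p q ℕ.* δ< p q) · α + (DᵀD p q ℕ.* δ≡ p q) · β
          ∎
        where
        open SetoidReasoning setoid
        ee : Fin b → ℕ
        ee l = e l p ℕ.* e l q

      [n+1]·β≈ : suc n · β ≈ a * (a - 1#) * (1/ 2)
      [n+1]·β≈ = begin
        suc n · (x * (1/ suc n))  ≈⟨ SemiringMult.×-comm-* semiring (suc n) x (1/ suc n) ⟨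
        x * (suc n · (1/ suc n))  ≈⟨ *-congˡ (n·1/n≈1 (suc n)) ⟩
        x * 1#                    ≈⟨ *-identityʳ x ⟩
        x                         ∎
        where
        open SetoidReasoning setoid
        x = a * (a - 1#) * (1/ 2)

      complete : ∀ p q → ∑[ l < b ] amount l p q ≈ comparisons F (λ g → N · s g) p q
      complete p q = trans (∑amount p q) (cases p q)
        where
        cases : ∀ p q → (DᵀD p q ℕ.* δ< p q) · α + (DᵀD p q ℕ.* δ≡ p q) · β
                        ≈ comparisons F (λ g → N · s g) p q
        cases p q with <-cmp p q
        -- The surviving coefficient is 1 for two different groups. On the diagonal it is `suc n`,
        -- and that many shares `β` make up the whole work inside the group.
        ... | tri< _ p≢q _ = trans
          (+-cong (trans (·-congˡ (≡.cong (ℕ._* 1) (DᵀD-offDiagonal p≢q))) (+-identityʳ α))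
                  (·-congˡ (ℕ.*-zeroʳ (DᵀD p q))))
          (+-identityʳ α)
        ... | tri≈ _ ≡.refl _ = trans
          (+-cong (·-congˡ (ℕ.*-zeroʳ (DᵀD p p)))
                  (trans (·-congˡ (≡.trans (ℕ.*-identityʳ (DᵀD p p)) (DᵀD-diagonal p))) [n+1]·β≈))
          (+-identityˡ _)
        ... | tri> _ _ _ = trans
          (+-cong (·-congˡ (ℕ.*-zeroʳ (DᵀD p q))) (·-congˡ (ℕ.*-zeroʳ (DᵀD p q))))
          (+-identityˡ 0#)

      schedule : Schedule F d N
      schedule = record
        { amount = amount ; amount≥0 = amount≥0 ; onHolders = onHolders ; complete = complete }

      -- The only part of the right side that mentions the line is `pairsOn l`, so equal loads
      -- reduce to `pairsOn-constant`.
      load≈ : ∀ l → Schedule.load schedule l ≈ pairsOn l · α + k · β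
      load≈ l = begin
        ∑[ p < v ] ∑[ q < v ] amount l p q
          ≈⟨ sum-cong-≋ (λ p → ∑-distrib-+ (λ q → A p q · α) (λ q → B p q · β)) ⟩
        ∑[ p < v ] (∑[ q < v ] (A p q · α) + ∑[ q < v ] (B p q · β))
          ≈⟨ ∑-distrib-+ (λ p → ∑[ q < v ] (A p q · α)) (λ p → ∑[ q < v ] (B p q · β)) ⟩
        ∑[ p < v ] ∑[ q < v ] (A p q · α) + ∑[ p < v ] ∑[ q < v ] (B p q · β)
          ≈⟨ +-cong (∑∑-· A α) (∑∑-· B β) ⟨
        pairsOn l · α + ∑ℕ (λ p → ∑ℕ (B p)) · β
          ≈⟨ +-congˡ (·-congˡ (diagonalOn≡k l)) ⟩
        pairsOn l · α + k · β
          ∎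
        where
        open SetoidReasoning setoid
        A B : Fin v → Fin v → ℕ
        A p q = e l p ℕ.* e l q ℕ.* δ< p q
        B p q = e l p ℕ.* e l q ℕ.* δ≡ p q

        ∑∑-· : ∀ (f : Fin v → Fin v → ℕ) x →
               ∑ℕ (λ p → ∑ℕ (f p)) · x ≈ ∑[ p < v ] ∑[ q < v ] (f p q · x)
        ∑∑-· f x = trans (∑ℕ-· (λ p → ∑ℕ (f p)) x) (sum-cong-≋ λ p → ∑ℕ-· (f p) x)

    canBeLoadBalanced : CanBeLoadBalanced F d
    canBeLoadBalanced N large = schedule N large , λ l l′ →
      trans (load≈ N large l)
        (trans (+-congʳ (·-congˡ (pairsOn-constant l l′))) (sym (load≈ N large l′)))

-- Projective and affine planes as instances.

open import Data.Nat.Base using (_+_; _*_; _^_)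

corollary15 : ∀ {c ℓ₁ ℓ₂} (F : OrderedField c ℓ₁ ℓ₂) (n : ℕ) →
    ((P : ProjectivePlane n) →
    CanBeLoadBalanced F (derivedᴾ F P) ×
    IsLmin F (n ^ 2 + n + 1) {{n²+n+1≢0 n}} (L F {{n²+n+1≢0 n}} (derivedᴾ F P)))
    ×
    (.{{_ : NonZero n}} (A : AffinePlane n) →
    CanBeLoadBalanced F (derivedᴬ F A) ×
    IsLmin F (n ^ 2 + n) {{n²+n≢0 n}} (L F {{n²+n≢0 n}} (derivedᴬ F A)))
corollary15 F n = projective , affine
  where
  -- The solver does not treat _^_, so n ^ 2 appears as its normal form n * (n * 1).
  projective-bk : ∀ n → (n * (n * 1) + n + 1) * (n + 1) ≡ suc n * (n * (n * 1) + n + 1)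
  projective-bk = solve-∀

  projective-nk : ∀ n → n * (n + 1) ≡ n * (n * 1) + n
  projective-nk = solve-∀

  affine-bk : ∀ n → (n * (n * 1) + n) * n ≡ suc n * (n * (n * 1))
  affine-bk = solve-∀

  affine-nk : ∀ n → n * n ≡ n * (n * 1)
  affine-nk = solve-∀

  projective : (P : ProjectivePlane n) → _
  projective P = canBeLoadBalanced ,
    -- Here k = n + 1, so n · k = n² + n falls short of the number of points by one.
    isLmin (projective-bk n) (ℕ.≤-trans (ℕ.≤-reflexive (projective-nk n)) (ℕ.m≤m+n (n ^ 2 + n) 1))
    where
    open ProjectivePlane P
    open Design F {{n²+n+1≢0 n}} {{n²+n+1≢0 n}} incidence join (n + 1) n pointsOn≡
      (λ p → ≡.trans (linesThrough≡ p) (ℕ.+-comm n 1))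

  affine : .{{_ : NonZero n}} (A : AffinePlane n) → _
  -- Here k = n, so n · k is exactly the number n² of points and the condition n · ℓ ≤ 1 is attained
  -- with equality.
  affine A = canBeLoadBalanced , isLmin (affine-bk n) (ℕ.≤-reflexive (affine-nk n))
    where
    open AffinePlane A
    open Design F {{ℕ.m^n≢0 n 2}} {{n²+n≢0 n}} incidence join n n pointsOn≡
      (λ p → ≡.trans (linesThrough≡ p) (ℕ.+-comm n 1))
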